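{- For all integers $a,b\ge1$, $\phi(p_{a,b})=-(-1)^{a+b}$.
   Context: $p_{a,b}=\sum_{i\in\mathbb{Z}}x_i^ax_{ -i}^b$ in commuting variables $x_i$, $i\in\mathbb{Z}$. A signed graph is a finite graph (loops and multiple edges allowed) with $\mathrm{sgn}:E\to\{+,-\}$; a coloring $\kappa:V\to\mathbb{Z}$ is proper if $\kappa(u)\ne\mathrm{sgn}(e)\kappa(v)$ for every edge $e$ with endpoints $u,v$. An orientation assigns to each half-edge (a loop has two) an arrow toward or away from the vertex, such that on a positive edge exactly one of the two arrows points toward its vertex and on a negative edge both point toward or both point away. A cycle is a closed walk in which, considering only the edges of the walk, every vertex of the walk has at least one arrow pointing into it and one pointing out of it; an orientation is acyclic if it has no cycle; a sink is a vertex all of whose incident arrows point toward it (an isolated vertex is a sink). A signed poset is an acyclic orientation $P$ of a signed graph. A proper coloring $\kappa$ preserves $P$ if for every edge $e$ and each endpoint $v$ of $e$, with $u$ the other endpoint ($u=v$ for a loop), the arrow of $P$ at the incidence of $e$ with $v$ points toward $v$ iff $\kappa(v)>\mathrm{sgn}(e)\kappa(u)$. $Y_P=\sum_\kappa\prod_v x_{\kappa(v)}$ over proper colorings preserving $P$; $\mathbb{Y}$ is the $\mathbb{Q}$-span of all $Y_P$ (it is closed under products and contains $p_{a,b}$ for $a\ge1,b\ge0$ and $x_0$). $\phi:\mathbb{Y}\to\mathbb{Q}[t]$ is the (unique) $\mathbb{Q}$-linear map with $\phi(Y_P)=t^{\mathrm{sink}(P)}$, $\mathrm{sink}(P)$ the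 number of sinks of $P$ (its existence is established in the paper). -}

module Defs where

open import Algebra.Module.Bundles.Raw using (RawLeftModule)
open import Data.Fin as Fin using (Fin; opposite)
import Data.Fin.Properties as Fin
open import Data.Integer as ℤ using (ℤ; +_; ∣_∣)
import Data.Integer.Properties as ℤ
open import Data.List using (List; []; _∷_; [_]; _++_; map; filter; length; replicate; upTo; allFin; cartesianProductWith)
open import Data.List.Membership.Propositional using (_∈_)
open import Data.List.Properties using (filter-≐; ≡-dec)
open import Data.List.Relation.Binary.Permutation.Propositional using (_↭_; ↭-sym; ↭-trans; ↭-reflexive; ↭⇒↭ₛ)
open import Data.List.Relation.Binary.Permutation.Propositional.Properties using (map⁺)
open import Data.List.Relation.Binary.Pointwise using (Pointwise-≡⇒≡)
open import Data.List.Relation.Unary.All using (All)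
open import Data.List.Relation.Unary.Sorted.TotalOrder.Properties using (↗↭↗⇒≋)
open import Data.List.Sort.InsertionSort ℤ.≤-decTotalOrder using (insertionSort)
open import Data.List.Sort.Base ℤ.≤-totalOrder using (module SortingAlgorithm)
open import Data.Nat as ℕ using (ℕ; zero; suc)
open import Data.Nat.ListAction using (sum)
open import Data.Nat.ListAction.Properties using (sum-↭)
open import Data.Product using (∃; ∃-syntax; _×_; _,_; proj₁)
open import Data.Rational as ℚ using (ℚ; 0ℚ; 1ℚ)
open import Data.Sign using (Sign)
open import Data.Vec as Vec using (Vec; lookup; toList)
open import Function using (_⇔_; mk⇔; Equivalence; _on_)
open import Level using (0ℓ)
open import Relation.Binary using (DecidableEquality)
open import Relation.Binary.PropositionalEquality using (_≡_; _≢_; refl; trans; cong; cong₂)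
open import Relation.Nullary using (¬_; Dec; yes; no; ¬?; _×-dec_; _→-dec_)
open import Relation.Nullary.Decidable using (map′)
open import Relation.Unary using (Pred; Decidable)

-- In the commuting variables xᵢ, i ∈ ℤ, the list i₁ ∷ … ∷ iₖ ∷ [] stands for
-- xᵢ₁ ⋯ xᵢₖ, so two lists denote the same monomial exactly when they are
-- permutations of each other.
Monomial : Set
Monomial = List ℤ

_↭?_ : (m m′ : Monomial) → Dec (m ↭ m′)
m ↭? m′ = map′
  (λ eq → ↭-trans (↭-sym (sort-↭ m)) (↭-trans (↭-reflexive eq) (sort-↭ m′)))
  (λ m↭m′ → Pointwise-≡⇒≡ (↗↭↗⇒≋ ℤ.≤-totalOrder (sort-↗ m) (sort-↗ m′)
    (↭⇒↭ₛ (↭-trans (sort-↭ m) (↭-trans m↭m′ (↭-sym (sort-↭ m′)))))))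
  (sort m ≟ sort m′)
  where open SortingAlgorithm insertionSort
        _≟_ = ≡-dec ℤ._≟_

record Series : Set where
  field
    coeff   : Monomial → ℚ
    coeff-↭ : ∀ {m m′} → m ↭ m′ → coeff m ≡ coeff m′

open Series public

-- All variables occurring in m have index between - radius m and radius m.
radius : Monomial → ℕ
radius m = sum (map ∣_∣ m)

interval : ℕ → List ℤ
interval r = map (λ k → + k ℤ.- + r) (upTo (suc (r ℕ.+ r)))

-- The formal sum Σ_{a ∈ A, P a} mon a.  Here enum r has to list without
-- repetition a finite part of A that contains every a for which mon a
-- involves only variables of index between - r and r.  The coefficient of
-- m is then the number of all a ∈ A with P a and mon a = m.
formalSum : {A : Set} (enum : ℕ → List A) (mon : A → Monomial)
            {P : Pred A 0ℓ} → Decidable P → Series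
formalSum enum mon {P} P? = record
  { coeff   = λ m → + length (filter (select m) (enum (radius m))) ℚ./ 1
  ; coeff-↭ = λ {m} {m′} m↭m′ → cong (λ as → + length as ℚ./ 1) (trans
      (cong (λ r → filter (select m) (enum r)) (sum-↭ (map⁺ ∣_∣ m↭m′)))
      (filter-≐ (select m) (select m′)
        ( (λ (pa , eq) → pa , ↭-trans eq m↭m′)
        , (λ (pa , eq) → pa , ↭-trans eq (↭-sym m↭m′)))
        (enum (radius m′))))
  }
  where
  select : ∀ m → Decidable (λ a → P a × mon a ↭ m)
  select m a = P? a ×-dec (mon a ↭? m)

-- For a = b = 0 the sum is not a formal power series, and p 0 0 is a junk
-- value.
p : ℕ → ℕ → Series
p a b = formalSum interval (λ i → replicate a i ++ replicate b (ℤ.- i)) (λ _ → yes tt)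
  where open import Data.Unit using (tt)

seriesModule : RawLeftModule ℚ 0ℓ 0ℓ
seriesModule = record
  { Carrierᴹ = Series
  ; _≈ᴹ_     = λ f g → ∀ m → coeff f m ≡ coeff g m
  ; _+ᴹ_     = λ f g → record
    { coeff   = λ m → coeff f m ℚ.+ coeff g m
    ; coeff-↭ = λ eq → cong₂ ℚ._+_ (coeff-↭ f eq) (coeff-↭ g eq) }
  ; _*ₗ_     = _*ₗ_
  ; 0ᴹ       = record { coeff = λ _ → 0ℚ ; coeff-↭ = λ _ → refl }
  ; -ᴹ_      = (ℚ.- 1ℚ) *ₗ_
  }
  where
  _*ₗ_ : ℚ → Series → Series
  c *ₗ f = record
    { coeff   = λ m → c ℚ.* coeff f m
    ; coeff-↭ = λ eq → cong (c ℚ.*_) (coeff-↭ f eq) }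

module Series-Module = RawLeftModule seriesModule
open Series-Module using (_≈ᴹ_; _+ᴹ_; _*ₗ_; 0ᴹ)

-- The least ℚ-subspace containing every g i; resp makes it invariant under
-- equality of series.
data Span {I : Set} (g : I → Series) : Series → Set where
  gen   : ∀ i → Span g (g i)
  zero  : Span g 0ᴹ
  add   : ∀ {f h} → Span g f → Span g h → Span g (f +ᴹ h)
  scale : ∀ c {f} → Span g f → Span g (c *ₗ f)
  resp  : ∀ {f h} → f ≈ᴹ h → Span g f → Span g h

spanModule : {I : Set} → (I → Series) → RawLeftModule ℚ 0ℓ 0ℓ
spanModule g = record
  { Carrierᴹ = ∃ (Span g)
  ; _≈ᴹ_     = _≈ᴹ_ on proj₁
  ; _+ᴹ_     = λ (f , f∈) (h , h∈) → f +ᴹ h , add f∈ h∈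
  ; _*ₗ_     = λ c (f , f∈) → c *ₗ f , scale c f∈
  ; 0ᴹ       = 0ᴹ , zero
  ; -ᴹ_      = λ (f , f∈) → (ℚ.- 1ℚ) *ₗ f , scale (ℚ.- 1ℚ) f∈
  }

-- Coefficient lists, constant term first; lists that differ only by
-- trailing zeros denote the same polynomial.
Poly : Set
Poly = List ℚ

polyCoeff : Poly → ℕ → ℚ
polyCoeff []      _       = 0ℚ
polyCoeff (c ∷ _) zero    = c
polyCoeff (_ ∷ f) (suc k) = polyCoeff f k

_+ᵖ_ : Poly → Poly → Poly
[]      +ᵖ g       = g
(c ∷ f) +ᵖ []      = c ∷ f
(c ∷ f) +ᵖ (d ∷ g) = (c ℚ.+ d) ∷ (f +ᵖ g)

constant : ℚ → Poly
constant c = [ c ]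

t^_ : ℕ → Poly
t^ k = replicate k 0ℚ ++ [ 1ℚ ]

ℚ[t] : RawLeftModule ℚ 0ℓ 0ℓ
ℚ[t] = record
  { Carrierᴹ = Poly
  ; _≈ᴹ_     = λ f g → ∀ k → polyCoeff f k ≡ polyCoeff g k
  ; _+ᴹ_     = _+ᵖ_
  ; _*ₗ_     = λ c → map (c ℚ.*_)
  ; 0ᴹ       = []
  ; -ᴹ_      = map ((ℚ.- 1ℚ) ℚ.*_)
  }

-- Vertices are Fin order and edges are Fin size.  The half-edges of e are
-- the pairs (e , s) with s : Fin 2, so a loop has two half-edges; the other
-- half-edge of e is (e , opposite s).
record SignedGraph : Set where
  field
    order size : ℕ
    end        : Fin size → Fin 2 → Fin order
    sgn        : Fin size → Sign

data Arrow : Set where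
  toward away : Arrow

_≟ᵃ_ : DecidableEquality Arrow
toward ≟ᵃ toward = yes refl
toward ≟ᵃ away   = no λ ()
away   ≟ᵃ toward = no λ ()
away   ≟ᵃ away   = yes refl

Compatible : Sign → Arrow → Arrow → Set
Compatible Sign.+ x y = x ≢ y
Compatible Sign.- x y = x ≡ y

record Orientation (G : SignedGraph) : Set where
  open SignedGraph G
  field
    arrow      : Fin size → Fin 2 → Arrow
    compatible : ∀ e → Compatible (sgn e) (arrow e Fin.zero) (arrow e (Fin.suc Fin.zero))

module _ (G : SignedGraph) where
  open SignedGraph G

  data Walk : Fin order → Fin order → Set where
    stop : ∀ {v} → Walk v v
    step : ∀ e s {v} → Walk (end e (opposite s)) v → Walk (end e s) v

  walkVertices : ∀ {u v} → Walk u v → List (Fin order)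
  walkVertices {u} stop         = [ u ]
  walkVertices {u} (step _ _ w) = u ∷ walkVertices w

  walkEdges : ∀ {u v} → Walk u v → List (Fin size)
  walkEdges stop         = []
  walkEdges (step e _ w) = e ∷ walkEdges w

module _ {G : SignedGraph} (O : Orientation G) where
  open SignedGraph G
  open Orientation O

  HasArrow : ∀ {u v} → Walk G u v → Arrow → Fin order → Set
  HasArrow w d x = ∃[ e ] ∃[ s ] (e ∈ walkEdges G w × end e s ≡ x × arrow e s ≡ d)

  -- The walk without edges does not qualify, as no arrow is available at its
  -- vertex.
  IsCycle : ∀ {v} → Walk G v v → Set
  IsCycle w = All (λ x → HasArrow w toward x × HasArrow w away x) (walkVertices G w)

  Acyclic : Set
  Acyclic = ∀ {v} (w : Walk G v v) → ¬ IsCycle w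

  IsSink : Fin order → Set
  IsSink v = ∀ e s → end e s ≡ v → arrow e s ≡ toward

  isSink? : Decidable IsSink
  isSink? v = Fin.all? λ e → Fin.all? λ s → (end e s Fin.≟ v) →-dec (arrow e s ≟ᵃ toward)

record SignedPoset : Set where
  field
    graph       : SignedGraph
    orientation : Orientation graph
    acyclic     : Acyclic orientation

  open SignedGraph graph public
  open Orientation orientation public

sink : SignedPoset → ℕ
sink P = length (filter (isSink? orientation) (allFin order))
  where open SignedPoset P

infixr 8 _·_

_·_ : Sign → ℤ → ℤ
Sign.+ · i = i
Sign.- · i = ℤ.- i

vectors : ∀ {A : Set} n → List A → List (Vec A n)
vectors zero    _  = [ Vec.[] ]
vectors (suc n) as = cartesianProductWith Vec._∷_ as (vectors n as)

module _ (P : SignedPoset) where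
  open SignedPoset P

  Coloring : Set
  Coloring = Vec ℤ order

  Proper : Coloring → Set
  Proper κ = ∀ e s → lookup κ (end e s) ≢ sgn e · lookup κ (end e (opposite s))

  Preserves : Coloring → Set
  Preserves κ = ∀ e s →
    arrow e s ≡ toward ⇔ lookup κ (end e s) ℤ.> sgn e · lookup κ (end e (opposite s))

  proper? : Decidable Proper
  proper? κ = Fin.all? λ e → Fin.all? λ s → ¬? (_ ℤ.≟ _)

  preserves? : Decidable Preserves
  preserves? κ = Fin.all? λ e → Fin.all? λ s →
    let toward? = arrow e s ≟ᵃ toward
        larger? = sgn e · lookup κ (end e (opposite s)) ℤ.<? lookup κ (end e s)
    in map′ (λ (f , g) → mk⇔ f g) (λ eq → Equivalence.to eq , Equivalence.from eq)
            ((toward? →-dec larger?) ×-dec (larger? →-dec toward?))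

  Y : Series
  Y = formalSum (λ r → vectors order (interval r)) toList
                (λ κ → proper? κ ×-dec preserves? κ)

𝕐 : RawLeftModule ℚ 0ℓ 0ℓ
𝕐 = spanModule Y

{-# OPTIONS --safe #-}

-- Write p_{a,b} as the sum over an index i of the monomial obtained by gluing
-- a + b vertices, each coloured i or - i according to its sign.  Start from a
-- star with centre coloured i.  A leaf of sign ε whose colour is forced to be
-- ε · i contributes "no edge" minus "leaf larger" minus "leaf smaller", so the
-- glued series is a combination of the Y P for stars P.  For a negative leaf
-- the first two stars have equally many sinks, and the third has none at the
-- centre; once such a leaf is glued, the centre no longer affects the value,
-- and every further gluing merely changes the sign.
module Submission where

open import Defs
open import Algebra.Module.Bundles.Raw using (RawLeftModule)
open import Algebra.Module.Morphism.Structures using (module LeftModuleMorphisms)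
open import Data.Bool using (true; false; if_then_else_)
open import Data.Fin as Fin using (Fin)
open import Data.Integer as ℤ using (ℤ; +_; -1ℤ)
import Data.Integer.Properties as ℤ
import Data.Integer.Solver
open import Data.List using (List; []; _∷_; [_]; _++_; map; filter; length; replicate; tabulate; cartesianProductWith)
import Data.List as List
open import Data.List.Membership.Propositional using (_∈_)
open import Data.List.Membership.Propositional.Properties using (∈-map⁺; ∈-map⁻; ∈-upTo⁺; ∈-upTo⁻; ∈-lookup)
open import Data.List.Properties using (filter-≐; filter-none; filter-accept; filter-reject; filter-++; length-++; length-replicate; ++-assoc; ++-identityʳ; map-cong-local; map-++; map-replicate)
open import Data.List.Relation.Binary.Permutation.Propositional using (_↭_; ↭-sym; ↭-trans; ↭-reflexive; module PermutationReasoning)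
open import Data.List.Relation.Binary.Permutation.Propositional.Properties using (shift; ++⁺ˡ; ++-comm)
open import Data.List.Relation.Unary.All as All using (All; []; _∷_)
open import Data.List.Relation.Unary.AllPairs using ([]; _∷_)
open import Data.List.Relation.Unary.Any using (here; there; index)
open import Data.List.Relation.Unary.Any.Properties using (lookup-index)
open import Data.List.Relation.Unary.Unique.Propositional using (Unique)
import Data.List.Relation.Unary.Unique.Propositional.Properties as Unique
open import Data.Maybe using (Maybe; just; nothing)
open import Data.Nat as ℕ using (ℕ; zero; suc; _+_; _∸_; _≥_; s≤s)
open import Data.Nat.ListAction using (sum)
import Data.Nat.Properties as ℕ
open import Data.Product using (Σ; ∃-syntax; _×_; _,_; proj₁; proj₂; map₁)
open import Data.Rational as ℚ using (ℚ; 1ℚ; _/_)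
import Data.Rational.Properties as ℚ
import Data.Rational.Solver
import Data.Rational.Unnormalised as ℚᵘ
import Data.Rational.Unnormalised.Properties as ℚᵘ
open import Data.Sign using (Sign)
open import Data.Sum using (_⊎_; inj₁; inj₂)
open import Data.Unit using (⊤; tt)
open import Data.Vec as Vec using (Vec; []; _∷_; lookup; toList)
open import Data.Vec.Relation.Binary.Pointwise.Inductive as Pointwise using (Pointwise; []; _∷_)
open import Data.Vec.Relation.Unary.All as VecAll using ([]; _∷_)
open import Data.Vec.Relation.Unary.All.Properties using (lookup⁺; lookup⁻)
open import Function using (_∘_; _⇔_; mk⇔; Equivalence)
open import Level using (0ℓ)
open import Relation.Binary using (Tri; tri<; tri≈; tri>)
open import Relation.Binary.PropositionalEquality using (_≡_; _≢_; refl; sym; trans; cong; cong₂; subst; module ≡-Reasoning)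
open import Relation.Nullary using (yes; no; does; _×-dec_; contradiction)
open import Relation.Nullary.Decidable using (does-⇔)
open import Relation.Unary using (Pred; Decidable; _⊆_)
open RawLeftModule using (Carrierᴹ)
open RawLeftModule ℚ[t] using (_≈ᴹ_)
open LeftModuleMorphisms 𝕐 ℚ[t] using (IsLeftModuleHomomorphism)
open Series-Module using (_+ᴹ_; _*ₗ_) renaming (_≈ᴹ_ to _≈ˢ_)
open Equivalence using (to; from)

private variable
  A B C : Set
  k : ℕ

-- Counting

number : {P : Pred A 0ℓ} → Decidable P → List A → ℕ
number P? xs = length (filter P? xs)

number-cong : {P Q : Pred A 0ℓ} (P? : Decidable P) (Q? : Decidable Q) → (∀ x → P x ⇔ Q x) →
              ∀ xs → number P? xs ≡ number Q? xs
number-cong P? Q? P⇔Q xs =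
  cong length (filter-≐ P? Q? ((λ {x} → to (P⇔Q x)) , (λ {x} → from (P⇔Q x))) xs)

number-∷ : {P : Pred A 0ℓ} (P? : Decidable P) → ∀ x xs →
           number P? (x ∷ xs) ≡ (if does (P? x) then 1 else 0) + number P? xs
number-∷ P? x xs with does (P? x)
... | true  = refl
... | false = refl

number-map : {P : Pred B 0ℓ} (P? : Decidable P) (f : A → B) → ∀ xs →
             number P? (map f xs) ≡ number (λ x → P? (f x)) xs
number-map P? f []       = refl
number-map P? f (x ∷ xs) with does (P? (f x))
... | true  = cong suc (number-map P? f xs)
... | false = number-map P? f xs

number-++ : {P : Pred A 0ℓ} (P? : Decidable P) → ∀ xs ys →
            number P? (xs ++ ys) ≡ number P? xs + number P? ys
number-++ P? xs ys = trans (cong length (filter-++ P? xs ys)) (length-++ (filter P? xs))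

number-product : {P : Pred C 0ℓ} (P? : Decidable P) (f : A → B → C) → ∀ xs ys →
  number P? (cartesianProductWith f xs ys) ≡ sum (map (λ x → number (λ y → P? (f x y)) ys) xs)
number-product P? f []       ys = refl
number-product P? f (x ∷ xs) ys = trans
  (number-++ P? (map (f x) ys) (cartesianProductWith f xs ys))
  (cong₂ _+_ (number-map P? (f x) ys) (number-product P? f xs ys))

sum-zero : (c : A → ℕ) → ∀ {xs} → All (λ x → c x ≡ 0) xs → sum (map c xs) ≡ 0
sum-zero c []         = refl
sum-zero c (eq ∷ eqs) = cong₂ _+_ eq (sum-zero c eqs)

sum-single : (c : A → ℕ) → ∀ {x xs} → Unique xs → x ∈ xs → (∀ y → y ≢ x → c y ≡ 0) →
             sum (map c xs) ≡ c x
sum-single c (x∉ ∷ _) (here refl) c≡0 =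
  trans (cong₂ _+_ refl (sum-zero c (All.map (λ x≢y → c≡0 _ (x≢y ∘ sym)) x∉))) (ℕ.+-identityʳ _)
sum-single c (y∉ ∷ u) (there x∈)  c≡0 =
  cong₂ _+_ (c≡0 _ (All.lookup y∉ x∈)) (sum-single c u x∈ c≡0)

-- If `P` pins the first factor to `x`, the other rows of the product contribute nothing. This
-- removes the coordinate of a leaf whose colour is determined by the centre.
number-single : {P : Pred C 0ℓ} (P? : Decidable P) (f : A → B → C) → ∀ {x xs} ys →
  Unique xs → x ∈ xs → (∀ {x′ y} → P (f x′ y) → x′ ≡ x) →
  number P? (cartesianProductWith f xs ys) ≡ number (λ y → P? (f x y)) ys
number-single P? f {xs = xs} ys unique x∈ P⇒≡ = trans (number-product P? f xs ys)
  (sum-single _ unique x∈ λ x′ x′≢x → cong length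
    (filter-none (λ y → P? (f x′ y)) (All.universal (λ y Pxy → x′≢x (P⇒≡ Pxy)) ys)))

-- On `P`, `Tri` says both that the three cases are exhaustive and that they exclude each other; the
-- inclusions keep elements outside `P` out of the right-hand side.
number-split : {P Q R S : Pred A 0ℓ}
  (P? : Decidable P) (Q? : Decidable Q) (R? : Decidable R) (S? : Decidable S) →
  Q ⊆ P → R ⊆ P → S ⊆ P → (∀ {x} → P x → Tri (Q x) (R x) (S x)) →
  ∀ xs → number P? xs ≡ number Q? xs + (number R? xs + number S? xs)
number-split P? Q? R? S? Q⊆P R⊆P S⊆P tri = go
  where
  go : ∀ xs → number P? xs ≡ number Q? xs + (number R? xs + number S? xs)
  go []       = refl
  go (x ∷ xs) with P? x
  ... | no ¬p
    rewrite filter-reject Q? {xs = xs} (¬p ∘ Q⊆P)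
          | filter-reject R? {xs = xs} (¬p ∘ R⊆P)
          | filter-reject S? {xs = xs} (¬p ∘ S⊆P) = go xs
  ... | yes p with tri p
  ...   | tri< q ¬r ¬s
    rewrite filter-accept Q? {xs = xs} q
          | filter-reject R? {xs = xs} ¬r
          | filter-reject S? {xs = xs} ¬s = cong suc (go xs)
  ...   | tri≈ ¬q r ¬s
    rewrite filter-reject Q? {xs = xs} ¬q
          | filter-accept R? {xs = xs} r
          | filter-reject S? {xs = xs} ¬s = trans (cong suc (go xs)) (sym (ℕ.+-suc (number Q? xs) _))
  ...   | tri> ¬q ¬r s
    rewrite filter-reject Q? {xs = xs} ¬q
          | filter-reject R? {xs = xs} ¬r
          | filter-accept S? {xs = xs} s =
            trans (cong suc (go xs)) (trans (sym (ℕ.+-suc (number Q? xs) _))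
              (cong (λ n → number Q? xs + n) (sym (ℕ.+-suc (number R? xs) _))))

number-tabulate : {P : Pred A 0ℓ} {Q : Pred B 0ℓ} (P? : Decidable P) (Q? : Decidable Q)
  (u : Vec B k) (f : Fin k → A) →
  (∀ j → P (f j) ⇔ Q (lookup u j)) → number P? (tabulate f) ≡ Vec.count Q? u
number-tabulate P? Q? []      f P⇔Q = refl
number-tabulate P? Q? (x ∷ u) f P⇔Q
  with ih ← number-tabulate P? Q? u (f ∘ Fin.suc) (P⇔Q ∘ Fin.suc)
     | P? (f Fin.zero) | Q? x
... | yes _ | yes _ = cong suc ih
... | no _  | no _  = ih
... | yes p | no ¬q = contradiction (to (P⇔Q Fin.zero) p) ¬q
... | no ¬p | yes q = contradiction (from (P⇔Q Fin.zero) q) ¬p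

-- Signs and intervals

·-involutive : ∀ ε i → ε · ε · i ≡ i
·-involutive Sign.+ i = refl
·-involutive Sign.- i = ℤ.neg-involutive i

-- Negation reverses the interval, sending position `k` to position `r + r ∸ k`. So a leaf colour
-- `ε · i` is enumerated whenever the centre colour `i` is.
·-∈-interval : ∀ ε {i r} → i ∈ interval r → ε · i ∈ interval r
·-∈-interval Sign.+ i∈ = i∈
·-∈-interval Sign.- {r = r} i∈ with ∈-map⁻ _ i∈
... | k , k∈ , refl = subst (_∈ interval r) reflect
  (∈-map⁺ (λ k → + k ℤ.- + r) (∈-upTo⁺ (s≤s (ℕ.m∸n≤m (r + r) k))))
  where
  open ≡-Reasoning
  -- With this bound the truncated difference agrees with the integer difference.
  k≤2r : k ℕ.≤ r + r
  k≤2r = ℕ.≤-pred (∈-upTo⁻ k∈)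
  reflect : + (r + r ∸ k) ℤ.- + r ≡ ℤ.- (+ k ℤ.- + r)
  reflect = begin
    + (r + r ∸ k) ℤ.- + r               ≡⟨ cong (ℤ._- + r) (ℤ.⊖-≥ k≤2r) ⟨
    ((r + r) ℤ.⊖ k) ℤ.- + r             ≡⟨ cong (ℤ._- + r) (ℤ.m-n≡m⊖n (r + r) k) ⟨
    (+ (r + r) ℤ.- + k) ℤ.- + r         ≡⟨ cong (λ s → (s ℤ.- + k) ℤ.- + r) (ℤ.pos-+ r r) ⟩
    ((+ r ℤ.+ + r) ℤ.- + k) ℤ.- + r     ≡⟨ solve 2 (λ r k → ((r :+ r) :- k) :- r := :- (k :- r)) refl (+ r) (+ k) ⟩
    ℤ.- (+ k ℤ.- + r)                   ∎
    where
    open Data.Integer.Solver.+-*-Solver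

interval-unique : ∀ r → Unique (interval r)
interval-unique r = Unique.map⁺
  (λ {k} {l} eq → ℤ.+-injective (∙-cancelʳ (ℤ.- + r) (+ k) (+ l) eq))
  (Unique.upTo⁺ _)
  where open import Algebra.Properties.AbelianGroup ℤ.+-0-abelianGroup using (∙-cancelʳ)

-- Stars

-- The state of a leaf: no edge to the centre, or an edge of the given sign
-- whose arrow at the leaf is as given.
State : Set
State = Maybe (Sign × Arrow)

-- Edges must be indexed by a `Fin`: the edges of a star are the positions in this list, which
-- passes over the leaves in state `nothing`.
links : Vec State k → List (Fin k × Sign × Arrow)
links []             = []
links (nothing ∷ u)  = map (map₁ Fin.suc) (links u)
links (just εd ∷ u)  = (Fin.zero , εd) ∷ map (map₁ Fin.suc) (links u)

links-sound : (u : Vec State k) → ∀ {j εd} → (j , εd) ∈ links u → lookup u j ≡ just εd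
links-sound (nothing ∷ u) l∈ with ∈-map⁻ _ l∈
... | _ , l∈′ , refl = links-sound u l∈′
links-sound (just _ ∷ u) (here refl) = refl
links-sound (just _ ∷ u) (there l∈) with ∈-map⁻ _ l∈
... | _ , l∈′ , refl = links-sound u l∈′

links-complete : (u : Vec State k) → ∀ j {εd} → lookup u j ≡ just εd → (j , εd) ∈ links u
links-complete (just _ ∷ u)  Fin.zero    refl = here refl
links-complete (nothing ∷ u) (Fin.suc j) eq   = ∈-map⁺ _ (links-complete u j eq)
links-complete (just _ ∷ u)  (Fin.suc j) eq   = there (∈-map⁺ _ (links-complete u j eq))

-- The sign of an edge and the arrow at its leaf determine the arrow at the centre, which is why a
-- `State` records only one arrow.
across : Sign → Arrow → Arrow
across Sign.+ toward = away
across Sign.+ away   = toward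
across Sign.- d      = d

across-compatible : ∀ ε d → Compatible ε (across ε d) d
across-compatible Sign.+ toward = λ ()
across-compatible Sign.+ away   = λ ()
across-compatible Sign.- d      = refl

module Star (u : Vec State k) where

  link : Fin (length (links u)) → Fin k × Sign × Arrow
  link = List.lookup (links u)

  graph : SignedGraph
  graph = record
    { order = suc k
    ; size  = length (links u)
    ; end   = λ { e Fin.zero → Fin.zero ; e (Fin.suc _) → Fin.suc (proj₁ (link e)) }
    ; sgn   = λ e → proj₁ (proj₂ (link e))
    }

  orientation : Orientation graph
  orientation = record
    { arrow      = λ { e Fin.zero    → across (proj₁ (proj₂ (link e))) (proj₂ (proj₂ (link e)))
                     ; e (Fin.suc _) → proj₂ (proj₂ (link e)) }
    ; compatible = λ e → across-compatible (proj₁ (proj₂ (link e))) (proj₂ (proj₂ (link e)))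
    }

  open SignedGraph graph
  open Orientation orientation

  link-state : ∀ e → lookup u (proj₁ (link e)) ≡ just (proj₂ (link e))
  link-state e = links-sound u (∈-lookup e)

  link-at : ∀ j {εd} → lookup u j ≡ just εd → ∃[ e ] link e ≡ (j , εd)
  link-at j eq = index l∈ , sym (lookup-index l∈)
    where l∈ = links-complete u j eq

  same-leaf : ∀ {e e′ j} → proj₁ (link e) ≡ j → proj₁ (link e′) ≡ j →
              proj₂ (link e) ≡ proj₂ (link e′)
  same-leaf {e} {e′} refl eq
    with trans (sym (link-state e)) (trans (cong (lookup u) (sym eq)) (link-state e′))
  ... | eq′ = just-injective eq′
    where open import Data.Maybe.Properties using (just-injective)

  start-visited : ∀ {x y} (w : Walk graph x y) → x ∈ walkVertices graph w
  start-visited stop         = here refl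
  start-visited (step _ _ _) = here refl

  -- Every edge of a star ends at a leaf, so a walk with an edge passes through a leaf, and that is
  -- the vertex at which the cycle condition fails.
  leaf-visited : ∀ {x y} (w : Walk graph x y) {e} → e ∈ walkEdges graph w →
                 Fin.suc (proj₁ (link e)) ∈ walkVertices graph w
  leaf-visited (step e Fin.zero w)             (here refl) = there (start-visited w)
  leaf-visited (step e (Fin.suc Fin.zero) w)   (here refl) = here refl
  leaf-visited (step e s w)                    (there e∈)  = there (leaf-visited w e∈)

  -- All edges at a leaf arise from its one state, so a leaf has no two
  -- different arrows.
  acyclic : Acyclic orientation
  acyclic w cyc with All.lookup cyc (start-visited w)
  ... | (e , _ , e∈ , _) , _ with All.lookup cyc (leaf-visited w e∈)
  ... | (e₁ , Fin.suc Fin.zero , _ , at₁ , tow) , (e₂ , Fin.suc Fin.zero , _ , at₂ , awa)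
    = contradiction (trans (sym tow) (trans (cong proj₂ (same-leaf {e₁} {e₂}
        (suc-injective at₁) (suc-injective at₂))) awa)) λ ()
    where open import Data.Fin.Properties using (suc-injective)

  poset : SignedPoset
  poset = record { graph = graph ; orientation = orientation ; acyclic = acyclic }

open Star using () renaming (poset to star)

-- Sinks of stars

-- State `nothing` qualifies: a leaf without an edge is isolated and hence a sink.
NotAway : Pred State 0ℓ
NotAway s = ∀ {ε} → s ≢ just (ε , away)

notAway? : Decidable NotAway
notAway? nothing            = yes λ ()
notAway? (just (_ , toward)) = yes λ ()
notAway? (just (_ , away))   = no λ na → na refl

CentreToward : Pred State 0ℓ
CentreToward nothing        = ⊤
CentreToward (just (ε , d)) = across ε d ≡ toward

centreToward? : Decidable CentreToward
centreToward? nothing        = yes tt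
centreToward? (just (ε , d)) = across ε d ≟ᵃ toward

leafSinks : Vec State k → ℕ
leafSinks = Vec.count notAway?

centreSinks : Vec State k → ℕ
centreSinks u = if does (VecAll.all? centreToward? u) then 1 else 0

module _ (u : Vec State k) where
  open Star u

  leaf-isSink : ∀ j → IsSink orientation (Fin.suc j) ⇔ NotAway (lookup u j)
  leaf-isSink j = mk⇔ sound complete
    where
    sound : IsSink orientation (Fin.suc j) → NotAway (lookup u j)
    sound isSink eq with link-at j eq
    ... | e , le = contradiction
      (trans (sym (cong (proj₂ ∘ proj₂) le)) (isSink e (Fin.suc Fin.zero) (cong (Fin.suc ∘ proj₁) le))) λ ()
    complete : NotAway (lookup u j) → IsSink orientation (Fin.suc j)
    complete na e (Fin.suc Fin.zero) refl
      with link e | link-state e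
    ... | _ , _ , toward | _  = refl
    ... | _ , _ , away   | eq = contradiction eq na

  centre-isSink : IsSink orientation Fin.zero ⇔ VecAll.All CentreToward u
  centre-isSink = mk⇔
    (λ isSink → lookup⁻ (sound isSink))
    complete
    where
    sound : IsSink orientation Fin.zero → ∀ j → CentreToward (lookup u j)
    sound isSink j with lookup u j in eq
    ... | nothing = tt
    ... | just (ε , d) with link-at j eq
    ... | e , le = subst (λ l → across (proj₁ (proj₂ l)) (proj₂ (proj₂ l)) ≡ toward) le
                         (isSink e Fin.zero refl)
    complete : VecAll.All CentreToward u → IsSink orientation Fin.zero
    complete all e Fin.zero refl =
      subst CentreToward (link-state e) (lookup⁺ all (proj₁ (link e)))

  -- The share of the centre is kept apart because it disappears from the exponent once a negative
  -- leaf has been glued.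
  sink-star : sink (star u) ≡ centreSinks u + leafSinks u
  sink-star = trans
    (number-∷ (isSink? orientation) Fin.zero (tabulate Fin.suc))
    (cong₂ (λ b n → (if b then 1 else 0) + n)
      (does-⇔ centre-isSink (isSink? orientation Fin.zero) (VecAll.all? centreToward? u))
      (number-tabulate (isSink? orientation) notAway? u Fin.suc leaf-isSink))

-- Gluing

-- An edge of sign `ε` forbids the colour `ε · i` at the leaf; the arrow decides on which side of it
-- `l` lies.
Obeys : ℤ → State → ℤ → Set
Obeys i nothing             l = ⊤
Obeys i (just (ε , toward)) l = ε · i ℤ.< l
Obeys i (just (ε , away))   l = l ℤ.< ε · i

obeys? : ∀ i s → Decidable (Obeys i s)
obeys? i nothing             l = yes tt
obeys? i (just (ε , toward)) l = ε · i ℤ.<? l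
obeys? i (just (ε , away))   l = l ℤ.<? ε · i

Respects : Vec State k → Pred (Vec ℤ (suc k)) 0ℓ
Respects u (i ∷ ls) = Pointwise (Obeys i) u ls

respects? : (u : Vec State k) → Decidable (Respects u)
respects? u (i ∷ ls) = Pointwise.decidable (obeys? i) u ls

gluedMonomial : List Sign → Vec ℤ (suc k) → Monomial
gluedMonomial M (i ∷ ls) = map (_· i) M ++ toList ls

-- The list M holds the signs of the vertices glued to the centre, which itself
-- is one of them, with sign +.
opaque
  gluedStar : List Sign → Vec State k → Series
  gluedStar {k} M u = formalSum (λ r → vectors (suc k) (interval r)) (gluedMonomial M) (respects? u)

Selected : Monomial → List Sign → Vec State k → Pred (Vec ℤ (suc k)) 0ℓ
Selected m M u κ = Respects u κ × gluedMonomial M κ ↭ m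

selected? : ∀ m M (u : Vec State k) → Decidable (Selected m M u)
selected? m M u κ = respects? u κ ×-dec (gluedMonomial M κ ↭? m)

gluedNumber : Monomial → List Sign → Vec State k → ℕ
gluedNumber {k} m M u = number (selected? m M u) (vectors (suc k) (interval (radius m)))

-- Colourings that preserve a star

module _ (u : Vec State k) where
  open Star u using (graph; link; link-state; link-at)
  open SignedPoset (star u) using (arrow)

  -- The inequality at the leaf already gives the one at the centre: for sign `+` it is the same
  -- inequality read from the other end, for sign `-` negation turns `ℤ.- i ℤ.< l` into
  -- `ℤ.- l ℤ.< i`.
  obeys-edge : ∀ ε d i l → Obeys i (just (ε , d)) l →
    l ≢ ε · i × i ≢ ε · l ×
    (d ≡ toward ⇔ l ℤ.> ε · i) × (across ε d ≡ toward ⇔ i ℤ.> ε · l)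
  obeys-edge ε d i l obeys = l≢ d obeys , i≢ , mk⇔ (λ { refl → obeys }) (leaf d obeys) , centre ε d obeys
    where
    l≢ : ∀ d → Obeys i (just (ε , d)) l → l ≢ ε · i
    l≢ toward lt eq = ℤ.<-irrefl (sym eq) lt
    l≢ away   lt eq = ℤ.<-irrefl eq lt
    i≢ : i ≢ ε · l
    i≢ refl = l≢ d obeys (sym (·-involutive ε l))
    leaf : ∀ d → Obeys i (just (ε , d)) l → l ℤ.> ε · i → d ≡ toward
    leaf toward _  _  = refl
    leaf away   lt gt = contradiction gt (ℤ.<-asym lt)
    -i<l⇒-l<i : ∀ {i l} → ℤ.- i ℤ.< l → ℤ.- l ℤ.< i
    -i<l⇒-l<i {i} lt = subst (_ ℤ.<_) (ℤ.neg-involutive i) (ℤ.neg-mono-< lt)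
    centre : ∀ ε d → Obeys i (just (ε , d)) l → across ε d ≡ toward ⇔ i ℤ.> ε · l
    centre Sign.+ toward lt = mk⇔ (λ ()) λ gt → contradiction gt (ℤ.<-asym lt)
    centre Sign.+ away   lt = mk⇔ (λ _ → lt) λ _ → refl
    centre Sign.- toward lt = mk⇔ (λ _ → -i<l⇒-l<i lt) λ _ → refl
    centre Sign.- away   lt = mk⇔ (λ ()) λ gt → contradiction (-i<l⇒-l<i gt) (ℤ.<-asym lt)

  -- For an `away` arrow the equivalence only denies `l ℤ.> ε · i`; properness excludes equality and
  -- leaves the strict inequality.
  edge-obeys : ∀ ε d i l → l ≢ ε · i → (d ≡ toward ⇔ l ℤ.> ε · i) → Obeys i (just (ε , d)) l
  edge-obeys ε toward i l l≢ d⇔ = to d⇔ refl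
  edge-obeys ε away   i l l≢ d⇔ with ℤ.<-cmp l (ε · i)
  ... | tri< lt _ _ = lt
  ... | tri≈ _ eq _ = contradiction eq l≢
  ... | tri> _ _ gt = contradiction (from d⇔ gt) λ ()

  preserves⇔respects : ∀ κ → (Proper (star u) κ × Preserves (star u) κ) ⇔ Respects u κ
  preserves⇔respects (i ∷ ls) = mk⇔
    (λ (proper , preserves) → Pointwise-tabulate λ j → sound proper preserves j)
    (λ os → (λ { e Fin.zero → proj₁ (proj₂ (edge os e))
                 ; e (Fin.suc Fin.zero) → proj₁ (edge os e) })
            , (λ { e Fin.zero → proj₂ (proj₂ (proj₂ (edge os e)))
                 ; e (Fin.suc Fin.zero) → proj₁ (proj₂ (proj₂ (edge os e))) }))
    where
    Pointwise-tabulate : ∀ {n} {us : Vec State n} {ls : Vec ℤ n} →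
      (∀ j → Obeys i (lookup us j) (lookup ls j)) → Pointwise (Obeys i) us ls
    Pointwise-tabulate {us = []}    {[]}    ob = []
    Pointwise-tabulate {us = _ ∷ _} {_ ∷ _} ob = ob Fin.zero ∷ Pointwise-tabulate (ob ∘ Fin.suc)
    sound : Proper (star u) (i ∷ ls) → Preserves (star u) (i ∷ ls) →
            ∀ j → Obeys i (lookup u j) (lookup ls j)
    sound proper preserves j with lookup u j in eq
    ... | nothing = tt
    ... | just (ε , d) with link-at j eq
    ... | e , le = subst (λ (j , ε , d) → Obeys i (just (ε , d)) (lookup ls j)) le
      (edge-obeys _ _ i _ (proper e (Fin.suc Fin.zero)) (preserves e (Fin.suc Fin.zero)))
    edge : Respects u (i ∷ ls) → ∀ e → let j , ε , d = link e ; l = lookup ls j in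
      l ≢ ε · i × i ≢ ε · l ×
      (d ≡ toward ⇔ l ℤ.> ε · i) × (across ε d ≡ toward ⇔ i ℤ.> ε · l)
    edge os e = obeys-edge _ _ i _
      (subst (λ s → Obeys i s (lookup ls (proj₁ (link e)))) (link-state e)
             (Pointwise.lookup os (proj₁ (link e))))

  opaque
    unfolding gluedStar

    -- With `[ Sign.+ ]` the centre contributes just its own colour, so the monomials agree by
    -- computation and only the selection conditions have to be compared.
    Y-star : Y (star u) ≈ˢ gluedStar [ Sign.+ ] u
    Y-star m = cong (λ n → + n / 1) (number-cong
      (λ κ → (proper? (star u) κ ×-dec preserves? (star u) κ) ×-dec (toList κ ↭? m))
      (selected? m [ Sign.+ ] u)
      (λ { κ@(_ ∷ _) → mk⇔ (λ (pp , m↭) → to (preserves⇔respects κ) pp , m↭)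
                           (λ (r , m↭) → from (preserves⇔respects κ) r , m↭) })
      (vectors (suc k) (interval (radius m))))

-- Glued stars without leaves

vectors-1 : (xs : List A) → vectors 1 xs ≡ map (_∷ []) xs
vectors-1 []       = refl
vectors-1 (x ∷ xs) = cong (_ ∷_) (vectors-1 xs)

opaque
  unfolding gluedStar

  -- Without leaves the colour `i` of the centre is the only summation index and `Respects` imposes
  -- nothing.
  gluedStar-p : ∀ {M a b} → (∀ i → map (_· i) M ↭ replicate a i ++ replicate b (ℤ.- i)) →
                gluedStar M [] ≈ˢ p a b
  gluedStar-p {M} {a} {b} M↭ m = cong (λ n → + n / 1) (begin
    gluedNumber m M []                              ≡⟨ cong (number (selected? m M [])) (vectors-1 I) ⟩
    number (selected? m M []) (map (_∷ []) I)       ≡⟨ number-map (selected? m M []) (_∷ []) I ⟩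
    number (λ i → selected? m M [] (i ∷ [])) I      ≡⟨ number-cong (λ i → selected? m M [] (i ∷ [])) powers?
      (λ i → mk⇔ (λ (_ , m↭) → tt , ↭-trans (↭-sym (mon i)) m↭)
                 (λ (_ , m↭) → [] , ↭-trans (mon i) m↭)) I ⟩
    number powers? I                                ∎)
    where
    open ≡-Reasoning
    I : List ℤ
    I = interval (radius m)
    powers? : Decidable (λ i → ⊤ × replicate a i ++ replicate b (ℤ.- i) ↭ m)
    powers? i = yes tt ×-dec ((replicate a i ++ replicate b (ℤ.- i)) ↭? m)
    mon : ∀ i → gluedMonomial M (i ∷ []) ↭ replicate a i ++ replicate b (ℤ.- i)
    mon i = ↭-trans (↭-reflexive (++-identityʳ _)) (M↭ i)

-- Gluing one leaf to the centre

module _ (M : List Sign) (ε : Sign) (u : Vec State k) (m : Monomial) where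

  private
    I : List ℤ
    I = interval (radius m)

    OnCentre : Pred (Vec ℤ (suc (suc k))) 0ℓ
    OnCentre (i ∷ l ∷ ls) = l ≡ ε · i × Selected m M (nothing ∷ u) (i ∷ l ∷ ls)

    onCentre? : Decidable OnCentre
    onCentre? (i ∷ l ∷ ls) = (l ℤ.≟ ε · i) ×-dec selected? m M (nothing ∷ u) (i ∷ l ∷ ls)

  -- For each `i` exactly one leaf colour survives, `ε · i`, and it is enumerated because intervals
  -- are symmetric. Deleting that coordinate leaves the colourings of the star with the leaf glued.
  number-onCentre : number onCentre? (vectors (suc (suc k)) I)
                  ≡ gluedNumber m (ε ∷ M) u
  number-onCentre = begin
    number onCentre? (vectors (suc (suc k)) I)
      ≡⟨ number-product onCentre? _∷_ I (vectors (suc k) I) ⟩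
    sum (map (λ i → number (λ κ → onCentre? (i ∷ κ)) (vectors (suc k) I)) I)
      ≡⟨ cong sum (map-cong-local {xs = I} (All.tabulate λ {i} i∈ → trans
           (number-single (λ κ → onCentre? (i ∷ κ)) _∷_ (vectors k I)
             (interval-unique (radius m)) (·-∈-interval ε {r = radius m} i∈) proj₁)
           (number-cong (λ ls → onCentre? (i ∷ ε · i ∷ ls)) (λ ls → selected? m (ε ∷ M) u (i ∷ ls))
             (glued i) (vectors k I)))) ⟩
    sum (map (λ i → number (λ κ → selected? m (ε ∷ M) u (i ∷ κ)) (vectors k I)) I)
      ≡⟨ number-product (selected? m (ε ∷ M) u) _∷_ I (vectors k I) ⟨
    number (selected? m (ε ∷ M) u) (vectors (suc k) I) ∎
    where
    open ≡-Reasoning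
    glued : ∀ i ls → OnCentre (i ∷ ε · i ∷ ls) ⇔ Selected m (ε ∷ M) u (i ∷ ls)
    glued i ls = mk⇔
      (λ { (_ , (_ ∷ os) , m↭) → os , ↭-trans (↭-sym move) m↭ })
      (λ (os , m↭) → refl , (tt ∷ os) , ↭-trans move m↭)
      -- The factor of the leaf moves in front of the factors of the centre, where `ε ∷ M` puts it.
      where move = shift (ε · i) (map (_· i) M) (toList ls)

  -- The summands are the three outcomes of comparing the colour `l` of the free leaf with `ε · i`;
  -- equality is the glued case.
  number-glue : gluedNumber m M (nothing ∷ u) ≡
    gluedNumber m M (just (ε , away) ∷ u)
    + (gluedNumber m (ε ∷ M) u + gluedNumber m M (just (ε , toward) ∷ u))
  number-glue = trans
    (number-split
      (selected? m M (nothing ∷ u)) (selected? m M (just (ε , away) ∷ u))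
      onCentre? (selected? m M (just (ε , toward) ∷ u))
      (λ { {_ ∷ _ ∷ _} ((_ ∷ os) , m↭) → (tt ∷ os) , m↭ })
      (λ { {_ ∷ _ ∷ _} (_ , sel) → sel })
      (λ { {_ ∷ _ ∷ _} ((_ ∷ os) , m↭) → (tt ∷ os) , m↭ })
      (λ {κ} → compare κ)
      (vectors (suc (suc k)) I))
    (cong (λ n → gluedNumber m M (just (ε , away) ∷ u)
              + (n + gluedNumber m M (just (ε , toward) ∷ u))) number-onCentre)
    where
    compare : ∀ κ → Selected m M (nothing ∷ u) κ →
              Tri (Selected m M (just (ε , away) ∷ u) κ) (OnCentre κ) (Selected m M (just (ε , toward) ∷ u) κ)
    compare (i ∷ l ∷ ls) ((_ ∷ os) , m↭) with ℤ.<-cmp l (ε · i)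
    ... | tri< lt ¬eq ¬gt = tri< ((lt ∷ os) , m↭) (¬eq ∘ proj₁) (λ { ((gt ∷ _) , _) → ¬gt gt })
    ... | tri≈ ¬lt eq ¬gt = tri≈ (λ { ((lt ∷ _) , _) → ¬lt lt }) (eq , (tt ∷ os) , m↭) (λ { ((gt ∷ _) , _) → ¬gt gt })
    ... | tri> ¬lt ¬eq gt = tri> (λ { ((lt ∷ _) , _) → ¬lt lt }) (¬eq ∘ proj₁) ((gt ∷ os) , m↭)

/1-homo-+ : ∀ m n → + (m + n) / 1 ≡ (+ m / 1) ℚ.+ (+ n / 1)
/1-homo-+ m n = ℚ.toℚᵘ-injective (begin
  ℚ.toℚᵘ (+ (m + n) / 1)                       ≈⟨ ℚ.toℚᵘ-fromℚᵘ _ ⟩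
  ℚᵘ.mkℚᵘ (+ (m + n)) 0                        ≈⟨ ℚᵘ.*≡* (cong (ℤ._* + 1) sum≡) ⟩
  ℚᵘ.mkℚᵘ (+ m) 0 ℚᵘ.+ ℚᵘ.mkℚᵘ (+ n) 0         ≈⟨ ℚᵘ.+-cong (ℚ.toℚᵘ-fromℚᵘ (ℚᵘ.mkℚᵘ (+ m) 0)) (ℚ.toℚᵘ-fromℚᵘ (ℚᵘ.mkℚᵘ (+ n) 0)) ⟨
  ℚ.toℚᵘ (+ m / 1) ℚᵘ.+ ℚ.toℚᵘ (+ n / 1)       ≈⟨ ℚ.toℚᵘ-homo-+ (+ m / 1) (+ n / 1) ⟨
  ℚ.toℚᵘ ((+ m / 1) ℚ.+ (+ n / 1))             ∎)
  where
  open ℚᵘ.≃-Reasoning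
  sum≡ : + (m + n) ≡ + m ℤ.* + 1 ℤ.+ + n ℤ.* + 1
  sum≡ = trans (ℤ.pos-+ m n) (sym (cong₂ ℤ._+_ (ℤ.*-identityʳ (+ m)) (ℤ.*-identityʳ (+ n))))

opaque
  unfolding gluedStar

  glue-coeff : ∀ M ε (u : Vec State k) m → coeff (gluedStar M (nothing ∷ u)) m
    ≡ coeff (gluedStar M (just (ε , away) ∷ u)) m
      ℚ.+ (coeff (gluedStar (ε ∷ M) u) m ℚ.+ coeff (gluedStar M (just (ε , toward) ∷ u)) m)
  glue-coeff M ε u m = trans (cong (λ n → + n / 1) (number-glue M ε u m))
    (trans (/1-homo-+ smaller _) (cong ((+ smaller / 1) ℚ.+_) (/1-homo-+ (gluedNumber m (ε ∷ M) u) _)))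
    where
    smaller : ℕ
    smaller = gluedNumber m M (just (ε , away) ∷ u)

-- The trichotomy for the leaf, solved for the case of equality. The free leaf and the larger leaf
-- come first, since their images will cancel.
glue : ∀ M ε (u : Vec State k) →
  (gluedStar M (nothing ∷ u) +ᴹ ((ℚ.- 1ℚ) *ₗ gluedStar M (just (ε , toward) ∷ u)
                              +ᴹ (ℚ.- 1ℚ) *ₗ gluedStar M (just (ε , away) ∷ u)))
  ≈ˢ gluedStar (ε ∷ M) u
glue M ε u m = begin
  free ℚ.+ ((ℚ.- 1ℚ) ℚ.* larger ℚ.+ (ℚ.- 1ℚ) ℚ.* smaller)
    ≡⟨ cong (ℚ._+ ((ℚ.- 1ℚ) ℚ.* larger ℚ.+ (ℚ.- 1ℚ) ℚ.* smaller)) (glue-coeff M ε u m) ⟩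
  (smaller ℚ.+ (glued ℚ.+ larger)) ℚ.+ ((ℚ.- 1ℚ) ℚ.* larger ℚ.+ (ℚ.- 1ℚ) ℚ.* smaller)
    ≡⟨ solve 3 (λ s g l → (s :+ (g :+ l)) :+ (con (ℚ.- 1ℚ) :* l :+ con (ℚ.- 1ℚ) :* s) := g)
         refl smaller glued larger ⟩
  glued ∎
  where
  open ≡-Reasoning
  open Data.Rational.Solver.+-*-Solver
  free larger smaller glued : ℚ
  free    = coeff (gluedStar M (nothing ∷ u)) m
  larger  = coeff (gluedStar M (just (ε , toward) ∷ u)) m
  smaller = coeff (gluedStar M (just (ε , away) ∷ u)) m
  glued   = coeff (gluedStar (ε ∷ M) u) m

-- The value of φ

-- The final `Sign.+` is the centre and the `Sign.-` before it the first leaf glued, so `a` positive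
-- and `b` negative leaves remain.
glued-signs : ∀ a b i →
  map (_· i) (replicate a Sign.+ ++ replicate b Sign.- ++ Sign.- ∷ Sign.+ ∷ [])
  ↭ replicate (suc a) i ++ replicate (suc b) (ℤ.- i)
glued-signs a b i = begin
  map (_· i) (replicate a Sign.+ ++ replicate b Sign.- ++ Sign.- ∷ Sign.+ ∷ [])
    ≡⟨ map-++ (_· i) (replicate a Sign.+) _ ⟩
  map (_· i) (replicate a Sign.+) ++ map (_· i) (replicate b Sign.- ++ Sign.- ∷ Sign.+ ∷ [])
    ≡⟨ cong₂ _++_ (map-replicate (_· i) a Sign.+) (map-++ (_· i) (replicate b Sign.-) _) ⟩
  replicate a i ++ map (_· i) (replicate b Sign.-) ++ ℤ.- i ∷ i ∷ []
    ≡⟨ cong (λ xs → replicate a i ++ xs ++ ℤ.- i ∷ i ∷ []) (map-replicate (_· i) b Sign.-) ⟩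
  replicate a i ++ replicate b (ℤ.- i) ++ ℤ.- i ∷ i ∷ []
    ↭⟨ ++⁺ˡ (replicate a i) (shift (ℤ.- i) (replicate b (ℤ.- i)) [ i ]) ⟩
  replicate a i ++ replicate (suc b) (ℤ.- i) ++ [ i ]
    ↭⟨ ++⁺ˡ (replicate a i) (++-comm (replicate (suc b) (ℤ.- i)) [ i ]) ⟩
  replicate a i ++ i ∷ replicate (suc b) (ℤ.- i)
    ↭⟨ shift i (replicate a i) (replicate (suc b) (ℤ.- i)) ⟩
  replicate (suc a) i ++ replicate (suc b) (ℤ.- i) ∎
  where open PermutationReasoning

-- Powers of -1

alternating : ℕ → ℚ
alternating zero    = 1ℚ
alternating (suc n) = ℚ.- alternating n

-- Leaves only two closed values, on which the division by 1 in `-1-power-/1` computes.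
-1-powers : ∀ n → -1ℤ ℤ.^ n ≡ + 1 ⊎ -1ℤ ℤ.^ n ≡ -1ℤ
-1-powers zero    = inj₁ refl
-1-powers (suc n) with -1ℤ ℤ.^ n | -1-powers n
... | _ | inj₁ refl = inj₂ refl
... | _ | inj₂ refl = inj₁ refl

-1-power-/1 : ∀ n → (-1ℤ ℤ.^ n) / 1 ≡ alternating n
-1-power-/1 zero    = refl
-1-power-/1 (suc n) = trans (negate (-1-powers n)) (cong ℚ.-_ (-1-power-/1 n))
  where
  negate : ∀ {z} → z ≡ + 1 ⊎ z ≡ -1ℤ → (-1ℤ ℤ.* z) / 1 ≡ ℚ.- (z / 1)
  negate (inj₁ refl) = refl
  negate (inj₂ refl) = refl

polyCoeff-+ : ∀ f g n → polyCoeff (f +ᵖ g) n ≡ polyCoeff f n ℚ.+ polyCoeff g n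
polyCoeff-+ []      g       n       = sym (ℚ.+-identityˡ _)
polyCoeff-+ (c ∷ f) []      n       = sym (ℚ.+-identityʳ _)
polyCoeff-+ (c ∷ f) (d ∷ g) zero    = refl
polyCoeff-+ (c ∷ f) (d ∷ g) (suc n) = polyCoeff-+ f g n

polyCoeff-* : ∀ c f n → polyCoeff (map (c ℚ.*_) f) n ≡ c ℚ.* polyCoeff f n
polyCoeff-* c []      n       = sym (ℚ.*-zeroʳ c)
polyCoeff-* c (d ∷ f) zero    = refl
polyCoeff-* c (d ∷ f) (suc n) = polyCoeff-* c f n

-- Images of glued stars

module _ (φ : Carrierᴹ 𝕐 → Poly) (φ-linear : IsLeftModuleHomomorphism φ)
         (φ-Y : ∀ P → φ (Y P , gen P) ≈ᴹ t^ (sink P)) where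

  open IsLeftModuleHomomorphism φ-linear

  -- The glued stars evaluated below are all sent to a scalar multiple of a single power of t, so a
  -- scalar `c` and an exponent `j` suffice. The span witness is carried along because `φ` takes it
  -- as part of its argument.
  record Value (f : Series) (c : ℚ) (j : ℕ) : Set where
    constructor _,_
    field
      spanned : Span Y f
      value   : ∀ n → polyCoeff (φ (f , spanned)) n ≡ c ℚ.* polyCoeff (t^ j) n

  value-≈ : ∀ {f g c j} → f ≈ˢ g → Value f c j → Value g c j
  value-≈ f≈g (f∈ , eq) = resp f≈g f∈ ,
    λ n → trans (sym (⟦⟧-cong {x = _ , f∈} {y = _ , resp f≈g f∈} f≈g n)) (eq n)

  value-star : (u : Vec State k) → Value (gluedStar [ Sign.+ ] u) 1ℚ (centreSinks u + leafSinks u)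
  value-star u = value-≈ (Y-star u) (gen (star u) , λ n → trans (φ-Y (star u) n)
    (trans (cong (λ j → polyCoeff (t^ j) n) (sink-star u)) (sym (ℚ.*-identityˡ _))))

  -- The images of `f` and `g` coincide and cancel; only that of `h`, with its sign changed, is
  -- left.
  value-combine : ∀ {f g h c j l} → Value f c j → Value g c j → Value h c l →
    Value (f +ᴹ ((ℚ.- 1ℚ) *ₗ g +ᴹ (ℚ.- 1ℚ) *ₗ h)) (ℚ.- c) l
  value-combine {c = c} {j} {l} (f∈ , f≡) (g∈ , g≡) (h∈ , h≡) = f+g+h∈ , λ n → begin
    polyCoeff (φ (_ , f+g+h∈)) n
      ≡⟨ additive f∈ g+h∈ n ⟩
    polyCoeff (φ (_ , f∈)) n ℚ.+ polyCoeff (φ (_ , g+h∈)) n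
      ≡⟨ cong₂ ℚ._+_ (f≡ n) (trans (additive (scale _ g∈) (scale _ h∈) n)
           (cong₂ ℚ._+_ (negated j g∈ g≡ n) (negated l h∈ h≡ n))) ⟩
    c ℚ.* T j n ℚ.+ ((ℚ.- 1ℚ) ℚ.* (c ℚ.* T j n) ℚ.+ (ℚ.- 1ℚ) ℚ.* (c ℚ.* T l n))
      ≡⟨ solve 3 (λ c x y → c :* x :+ (con (ℚ.- 1ℚ) :* (c :* x) :+ con (ℚ.- 1ℚ) :* (c :* y))
           := (:- c) :* y) refl c (T j n) (T l n) ⟩
    (ℚ.- c) ℚ.* T l n ∎
    where
    open ≡-Reasoning
    open Data.Rational.Solver.+-*-Solver
    T : ℕ → ℕ → ℚ
    T j n = polyCoeff (t^ j) n
    g+h∈ = add (scale (ℚ.- 1ℚ) g∈) (scale (ℚ.- 1ℚ) h∈)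
    f+g+h∈ = add f∈ g+h∈
    additive : ∀ {f g} (f∈ : Span Y f) (g∈ : Span Y g) n →
      polyCoeff (φ (_ , add f∈ g∈)) n ≡ polyCoeff (φ (_ , f∈)) n ℚ.+ polyCoeff (φ (_ , g∈)) n
    additive f∈ g∈ n = trans (+ᴹ-homo (_ , f∈) (_ , g∈) n) (polyCoeff-+ (φ (_ , f∈)) _ n)
    negated : ∀ i {f} (f∈ : Span Y f) → (∀ n → polyCoeff (φ (f , f∈)) n ≡ c ℚ.* T i n) →
      ∀ n → polyCoeff (φ (_ , scale (ℚ.- 1ℚ) f∈)) n ≡ (ℚ.- 1ℚ) ℚ.* (c ℚ.* T i n)
    negated i f∈ f≡ n = trans (*ₗ-homo (ℚ.- 1ℚ) (_ , f∈) n)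
      (trans (polyCoeff-* (ℚ.- 1ℚ) (φ (_ , f∈)) n) (cong ((ℚ.- 1ℚ) ℚ.*_) (f≡ n)))

  value-glue : ∀ M ε (u : Vec State k) {c j l} →
    Value (gluedStar M (nothing ∷ u)) c j →
    Value (gluedStar M (just (ε , toward) ∷ u)) c j →
    Value (gluedStar M (just (ε , away) ∷ u)) c l →
    Value (gluedStar (ε ∷ M) u) (ℚ.- c) l
  value-glue M ε u free larger smaller =
    value-≈ (glue M ε u) (value-combine free larger smaller)

  -- Induction on the signs glued after the first negative leaf. The vector `u` has to vary, since
  -- each gluing calls on three stars with one more leaf.
  value-gluedStar : ∀ M {k} (u : Vec State k) →
    Value (gluedStar (M ++ Sign.- ∷ Sign.+ ∷ []) u) (alternating (suc (length M))) (leafSinks u)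
  -- A negative edge has equal arrows at both ends. So `toward` leaves the sink status of the centre
  -- as with no edge, while `away` makes `centreSinks` zero. A positive edge would not do here: its
  -- `toward` leaf has an `away` arrow at the centre.
  value-gluedStar []      u = value-glue [ Sign.+ ] Sign.- u
    (value-star (nothing ∷ u))
    (value-star (just (Sign.- , toward) ∷ u))
    (value-star (just (Sign.- , away) ∷ u))
  -- The exponents now count leaves only, so either sign works: `nothing` and `toward` add one sink
  -- to those of `u`, `away` adds none.
  value-gluedStar (ε ∷ M) u = value-glue (M ++ Sign.- ∷ Sign.+ ∷ []) ε u
    (value-gluedStar M (nothing ∷ u))
    (value-gluedStar M (just (ε , toward) ∷ u))
    (value-gluedStar M (just (ε , away) ∷ u))

theorem6p7 : (φ : Carrierᴹ 𝕐 → Poly) →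
    IsLeftModuleHomomorphism φ →
    (∀ P → φ (Y P , gen P) ≈ᴹ t^ (sink P)) →
    ∀ (a b : ℕ) → a ≥ 1 → b ≥ 1 →
    Σ (Span Y (p a b)) λ p∈𝕐 →
    φ (p a b , p∈𝕐) ≈ᴹ constant ((ℤ.- (-1ℤ ℤ.^ (a + b))) / 1)
theorem6p7 φ φ-linear φ-Y (suc a) (suc b) _ _ = spanned , λ n →
  trans (value n) (trans (cong (ℚ._* polyCoeff (t^ 0) n) scalar) (constant-1 _ n))
  where
  signs : List Sign
  -- One positive sign is reserved for the centre and one negative sign for the first leaf; `a ≥ 1`
  -- and `b ≥ 1` provide them.
  signs = replicate a Sign.+ ++ replicate b Sign.-
  -- No leaf is left at the end, so the exponent is 0 and the image is constant.
  p-value : Value φ φ-linear φ-Y (p (suc a) (suc b)) (alternating (suc (length signs))) 0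
  p-value = value-≈ φ φ-linear φ-Y
    (gluedStar-p {signs ++ Sign.- ∷ Sign.+ ∷ []} {suc a} {suc b} λ i →
      subst (λ M → map (_· i) M ↭ replicate (suc a) i ++ replicate (suc b) (ℤ.- i))
            (sym (++-assoc (replicate a Sign.+) _ _)) (glued-signs a b i))
    (value-gluedStar φ φ-linear φ-Y signs [])
  open Value p-value using (spanned; value)
  length-signs : length signs ≡ a + b
  length-signs = trans (length-++ (replicate a Sign.+))
    (cong₂ _+_ (length-replicate a) (length-replicate b))
  -- The number of gluings is one less than `suc a + suc b`; the missing factor -1 is the outer
  -- minus sign.
  scalar : alternating (suc (length signs)) ≡ (ℤ.- (-1ℤ ℤ.^ (suc a + suc b))) / 1
  scalar = begin
    alternating (suc (length signs))       ≡⟨ cong (alternating ∘ suc) length-signs ⟩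
    alternating (suc (a + b))              ≡⟨ -1-power-/1 (suc (a + b)) ⟨
    (-1ℤ ℤ.^ suc (a + b)) / 1              ≡⟨ cong (λ n → (-1ℤ ℤ.^ n) / 1) (ℕ.+-suc a b) ⟨
    (-1ℤ ℤ.^ (a + suc b)) / 1              ≡⟨ cong (_/ 1) (ℤ.neg-involutive (-1ℤ ℤ.^ (a + suc b))) ⟨
    (ℤ.- ℤ.- (-1ℤ ℤ.^ (a + suc b))) / 1    ≡⟨ cong (λ z → (ℤ.- z) / 1) (ℤ.-1*i≡-i (-1ℤ ℤ.^ (a + suc b))) ⟨
    (ℤ.- (-1ℤ ℤ.^ (suc a + suc b))) / 1    ∎
    where open ≡-Reasoning
  constant-1 : ∀ c n → c ℚ.* polyCoeff (t^ 0) n ≡ polyCoeff (constant c) n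
  constant-1 c zero    = ℚ.*-identityʳ c
  constant-1 c (suc n) = ℚ.*-zeroʳ c
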